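{- For any fixed $\alpha,\delta\in(0,1)$ there is a constant $C>0$ such that for every sufficiently large $n$ there is a Boolean function $f:\{0,1\}^n\to\{0,1\}$ with $|f^{ -1}(1)|=\lfloor \alpha 2^n\rfloor$ (so $\mu(f)=\alpha$ up to rounding to a multiple of $2^{ -n}$) and $$J^+_S(f)<1-n^{ -C}$$ for every $S\subseteq[n]$ with $|S|=\lfloor(1/2-\delta)n\rfloor$.
   Context: For a finite set $T$, $\Omega(T)=\{0,1\}^T$ and $\mu_T$ is the uniform probability measure on $\Omega(T)$; $\mu=\mu_{[n]}$, $[n]=\{1,\dots,n\}$, and for Boolean $f$ on $\Omega([n])$, $\mu(f)=\mu(f^{ -1}(1))$. For $S\subseteq[n]$, writing points of $\Omega([n])$ as $(u,v)$ with $u\in\Omega([n]\setminus S)$, $v\in\Omega(S)$, define $J^+_S(f)=\mu_{[n]\setminus S}(\{u\in\Omega([n]\setminus S): \exists v\in\Omega(S),\ f(u,v)=1\})$, i.e. the probability that a uniformly random setting of the variables outside $S$ does not force $f=0$. -}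

module Defs where

open import Data.Bool using (Bool; true; false; if_then_else_; _∧_; _∨_)
open import Data.Nat using (ℕ; zero; suc; _+_; _*_; _∸_; _^_; _≤_; _<_)
open import Data.Fin using (Fin)
open import Data.Fin.Subset using (Subset; inside; outside; ∣_∣)
open import Data.Vec using (lookup)
open import Data.Vec.Functional as VF using ()
open import Data.List using (List; []; _∷_; map; concatMap; foldr)
open import Data.List.Base using (allFin)
open import Data.Product using (Σ; ∃; _×_)
open import Relation.Binary.PropositionalEquality using (_≡_)

-- Reals in the open interval (0,1), encoded by their canonical binary
-- expansion x = Σ_i bit i · 2^{-(i+1)}, which does not end in all 1s.
-- `nonzero` gives x > 0, `notAllOnes` gives x < 1 and uniqueness of
-- the expansion; every real in (0,1) has exactly one such code.

record UnitReal : Set where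
  field
    bit        : ℕ → Bool
    notAllOnes : ∀ N → ∃ λ m → N ≤ m × bit m ≡ false
    nonzero    : ∃ λ m → bit m ≡ true

open UnitReal public

b2n : Bool → ℕ
b2n true  = 1
b2n false = 0

floorPow2 : UnitReal → ℕ → ℕ
floorPow2 x zero    = 0
floorPow2 x (suc m) = 2 * floorPow2 x m + b2n (bit x m)

-- k = ⌊ (1/2 - δ) · n ⌋, i.e.  k ≤ (1/2 - δ)·n < k + 1.
-- Since the dyadic truncations floorPow2 δ m / 2^m increase to δ:
--   k ≤ (1/2-δ)n  ⇔  2δn ≤ n - 2k  ⇔  ∀ m, floorPow2 δ m·2n + 2k·2^m ≤ n·2^m
--   (1/2-δ)n < k+1 ⇔ 2δn > n-2k-2 ⇔ ∃ m, n·2^m < floorPow2 δ m·2n + (2k+2)·2^m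
IsFloorHalfMinus : UnitReal → ℕ → ℕ → Set
IsFloorHalfMinus δ n k =
  (∀ m → floorPow2 δ m * (2 * n) + (2 * k) * 2 ^ m ≤ n * 2 ^ m)
  × (∃ λ m → n * 2 ^ m < floorPow2 δ m * (2 * n) + (2 * k + 2) * 2 ^ m)

Point : ℕ → Set
Point n = Fin n → Bool

BoolFun : ℕ → Set
BoolFun n = Point n → Bool

cube : (n : ℕ) → List (Point n)
cube zero    = (λ ()) ∷ []
cube (suc n) = concatMap (λ x → (false VF.∷ x) ∷ (true VF.∷ x) ∷ []) (cube n)

countᵇ : {A : Set} → (A → Bool) → List A → ℕ
countᵇ p = foldr (λ a r → b2n (p a) + r) 0

anyᵇ : {A : Set} → (A → Bool) → List A → Bool
anyᵇ p = foldr (λ a r → p a ∨ r) false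

allᵇ : {A : Set} → (A → Bool) → List A → Bool
allᵇ p = foldr (λ a r → p a ∧ r) true

onesCount : {n : ℕ} → BoolFun n → ℕ
onesCount {n} f = countᵇ f (cube n)

-- Ω([n] \ S) is identified with the points of {0,1}^n that vanish on S
-- (a bijection u ↦ (u, 0)).
vanishesOn : {n : ℕ} → Subset n → Point n → Bool
vanishesOn {n} S u = allᵇ (λ i → if lookup S i then not' (u i) else true) (allFin n)
  where
  not' : Bool → Bool
  not' true  = false
  not' false = true

merge : {n : ℕ} → Subset n → Point n → Point n → Point n
merge S u v i = if lookup S i then v i else u i

-- number of u ∈ Ω([n]\S) such that ∃ v ∈ Ω(S), f(u,v) = 1
-- (v ranges over {0,1}^n; only its coordinates in S are used)
notForcedCount : {n : ℕ} → BoolFun n → Subset n → ℕ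
notForcedCount {n} f S =
  countᵇ (λ u → vanishesOn S u ∧ anyᵇ (λ v → f (merge S u v)) (cube n)) (cube n)

-- J⁺_S(f) = notForcedCount f S / 2^{n - |S|}.
-- J⁺_S(f) < 1 - n^{-C}  ⇔  N·n^C < (n^C - 1)·2^{n-|S|}
--                        ⇔  N·n^C + 2^{n-|S|} < n^C·2^{n-|S|}
JplusBelow : {n : ℕ} → BoolFun n → Subset n → ℕ → Set
JplusBelow {n} f S C =
  notForcedCount f S * n ^ C + 2 ^ (n ∸ ∣ S ∣) < n ^ C * 2 ^ (n ∸ ∣ S ∣)

-- Take f below f₀ = ⋀_{A ∈ F} ⋁_{i ∈ A} x_i, where F consists of k-subsets of [n]. If A ∈ F is
-- disjoint from S, then setting x = 0 on A forces f = 0, so J⁺_S(f) ≤ 1 - 2^{-k}; and by the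
-- union bound μ(f₀) ≥ 1 - |F| 2^{-k}. A set S of size at most (1/2 - 1/D) n is disjoint from at
-- least a fraction ((1 + 1/D) / 2)^k of the k-sets when k ≪ n / D, so about n (2 / (1 + 1/D))^k of
-- them, chosen greedily, suffice to avoid every such S. This is at most (1 - α) 2^k as soon as
-- (1 + 1/D)^k ≫ n, that is for some k = O(log n). Finally f₀ is trimmed to the exact measure.

module Submission where

open import Defs
open import Data.Bool using (Bool; T; true; false; if_then_else_; _∧_; _∨_; not)
open import Data.Bool.Properties using (∧-assoc; ∧-comm; ∧-zeroʳ; ∧-identityʳ)
open import Data.Fin using (Fin; zero; suc)
open import Data.Fin.Subset using (Subset; ∣_∣; _∪_)
open import Data.Fin.Subset.Properties using (∣⊥∣≡0; ∣p∣≤n)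
open import Data.List using (List; []; _∷_; length; concatMap; tabulate)
open import Data.List.Relation.Unary.All using (All; []; _∷_)
import Data.List.Relation.Unary.All as All
open import Data.List.Relation.Unary.Any using (here; there)
open import Data.List.Membership.Propositional using (_∈_)
open import Data.Nat using (ℕ; zero; suc; pred; _+_; _*_; _∸_; _^_; _⊓_; _≤_; _<_; _≤ᵇ_; _≤?_; _<?_; z≤n; s≤s; z<s; NonZero; >-nonZero; >-nonZero⁻¹; ≢-nonZero; ≢-nonZero⁻¹)
open import Data.Nat.Properties
open import Algebra.Properties.CommutativeSemigroup +-commutativeSemigroup using () renaming (interchange to +-interchange)
open import Algebra.Properties.CommutativeSemigroup *-commutativeSemigroup using (x∙yz≈y∙xz; xy∙z≈y∙xz) renaming (interchange to *-interchange)
open import Algebra.Properties.CommutativeMonoid.Sum +-0-commutativeMonoid using (sum; ∑-distrib-+)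
open import Data.Nat.Tactic.RingSolver using (solve-∀)
open import Data.Product using (Σ; ∃; _×_; _,_; proj₁; proj₂)
open import Data.Vec using ([]; _∷_; lookup; replicate; _[_]≔_)
open import Data.Vec.Functional as VF using ()
open import Function using (_∘_)
open import Relation.Binary.PropositionalEquality using (_≡_; refl; sym; trans; cong; cong₂; subst; module ≡-Reasoning)
open import Relation.Nullary using (yes; no; contradiction)

private
  variable
    A B : Set
    n : ℕ

-- Counting

countᵇ-cong : (p q : A → Bool) → (∀ a → p a ≡ q a) → ∀ xs → countᵇ p xs ≡ countᵇ q xs
countᵇ-cong p q h []       = refl
countᵇ-cong p q h (x ∷ xs) = cong₂ _+_ (cong b2n (h x)) (countᵇ-cong p q h xs)

countᵇ-mono : (p q : A → Bool) → (∀ a → p a ≡ true → q a ≡ true) →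
              ∀ xs → countᵇ p xs ≤ countᵇ q xs
countᵇ-mono p q h []       = z≤n
countᵇ-mono p q h (x ∷ xs) = +-mono-≤ (lem (p x) (q x) (h x)) (countᵇ-mono p q h xs)
  where
  lem : ∀ s t → (s ≡ true → t ≡ true) → b2n s ≤ b2n t
  lem false t h = z≤n
  lem true  t h rewrite h refl = ≤-refl

countᵇ-false : (xs : List A) → countᵇ (λ _ → false) xs ≡ 0
countᵇ-false []       = refl
countᵇ-false (x ∷ xs) = countᵇ-false xs

-- The inequality between bits encodes that p and q exclude each other and that each implies r.
countᵇ-disjoint : (p q r : A → Bool) → (∀ a → b2n (p a) + b2n (q a) ≤ b2n (r a)) →
                  ∀ xs → countᵇ p xs + countᵇ q xs ≤ countᵇ r xs
countᵇ-disjoint p q r h []       = z≤n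
countᵇ-disjoint p q r h (x ∷ xs) = begin
  b2n (p x) + countᵇ p xs + (b2n (q x) + countᵇ q xs)
    ≡⟨ +-interchange (b2n (p x)) (countᵇ p xs) (b2n (q x)) (countᵇ q xs) ⟩
  b2n (p x) + b2n (q x) + (countᵇ p xs + countᵇ q xs)
    ≤⟨ +-mono-≤ (h x) (countᵇ-disjoint p q r h xs) ⟩
  b2n (r x) + countᵇ r xs ∎
  where open ≤-Reasoning

countᵇ-cover : (p q r : A → Bool) → (∀ a → b2n (r a) ≤ b2n (p a) + b2n (q a)) →
               ∀ xs → countᵇ r xs ≤ countᵇ p xs + countᵇ q xs
countᵇ-cover p q r h []       = z≤n
countᵇ-cover p q r h (x ∷ xs) = begin
  b2n (r x) + countᵇ r xs
    ≤⟨ +-mono-≤ (h x) (countᵇ-cover p q r h xs) ⟩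
  b2n (p x) + b2n (q x) + (countᵇ p xs + countᵇ q xs)
    ≡⟨ +-interchange (b2n (p x)) (b2n (q x)) (countᵇ p xs) (countᵇ q xs) ⟩
  b2n (p x) + countᵇ p xs + (b2n (q x) + countᵇ q xs) ∎
  where open ≤-Reasoning

countᵇ-pairs : (p : B → Bool) (g h : A → B) (xs : List A) →
               countᵇ p (concatMap (λ x → g x ∷ h x ∷ []) xs)
               ≡ countᵇ (p ∘ g) xs + countᵇ (p ∘ h) xs
countᵇ-pairs p g h []       = refl
countᵇ-pairs p g h (x ∷ xs) rewrite countᵇ-pairs p g h xs =
  lem (b2n (p (g x))) (b2n (p (h x))) (countᵇ (p ∘ g) xs) (countᵇ (p ∘ h) xs)
  where
  lem : ∀ a b c d → a + (b + (c + d)) ≡ a + c + (b + d)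
  lem = solve-∀

onesCount-suc : (f : BoolFun (suc n)) →
                onesCount f ≡ onesCount (f ∘ (false VF.∷_)) + onesCount (f ∘ (true VF.∷_))
onesCount-suc {n} f = countᵇ-pairs f (false VF.∷_) (true VF.∷_) (cube n)

onesCount-true : ∀ n → onesCount {n} (λ _ → true) ≡ 2 ^ n
onesCount-true zero    = refl
onesCount-true (suc n)
  rewrite onesCount-suc {n} (λ _ → true) | onesCount-true n | +-identityʳ (2 ^ n) = refl

subsets : ∀ n → List (Subset n)
subsets zero    = [] ∷ []
subsets (suc n) = concatMap (λ S → (false ∷ S) ∷ (true ∷ S) ∷ []) (subsets n)

countᵇ-subsets-≤ : ∀ n (p : Subset n → Bool) → countᵇ p (subsets n) ≤ 2 ^ n
countᵇ-subsets-≤ zero p with p []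
... | true  = ≤-refl
... | false = z≤n
countᵇ-subsets-≤ (suc n) p
  rewrite countᵇ-pairs p (false ∷_) (true ∷_) (subsets n) | +-identityʳ (2 ^ n) =
  +-mono-≤ (countᵇ-subsets-≤ n _) (countᵇ-subsets-≤ n _)

-- Passes from a count to a statement about every single S, which is how the greedy counting bound
-- is finally used.
countᵇ-subsets-≡0 : ∀ n (p : Subset n → Bool) → countᵇ p (subsets n) ≡ 0 → ∀ S → p S ≡ false
countᵇ-subsets-≡0 zero p eq [] with p []
... | false = refl
... | true  = contradiction eq λ ()
countᵇ-subsets-≡0 (suc n) p eq (s ∷ S)
  with trans (sym (countᵇ-pairs p (false ∷_) (true ∷_) (subsets n))) eq | s
... | eq′ | false = countᵇ-subsets-≡0 n _ (m+n≡0⇒m≡0 _ eq′) S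
... | eq′ | true  = countᵇ-subsets-≡0 n _ (m+n≡0⇒n≡0 _ eq′) S

-- Induction on the dimension: the half with first coordinate `false` keeps as many ones as it can,
-- the other half keeps the rest. The mask enters by conjunction, so zeros of `f` stay zeros.
trim : ∀ n (f : BoolFun n) m → m ≤ onesCount f →
       Σ (BoolFun n) λ g → onesCount (λ x → f x ∧ g x) ≡ m
trim zero f zero m≤ = (λ _ → false) , lem (f (λ ()))
  where
  lem : ∀ b → b2n (b ∧ false) + 0 ≡ 0
  lem true  = refl
  lem false = refl
trim zero f (suc m) m≤ = (λ _ → true) , lem (f (λ ())) m≤
  where
  lem : ∀ b → suc m ≤ b2n b + 0 → b2n (b ∧ true) + 0 ≡ suc m
  lem true  (s≤s z≤n) = refl
trim (suc n) f m m≤ = g , (begin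
    onesCount (λ x → f x ∧ g x)                ≡⟨ onesCount-suc (λ x → f x ∧ g x) ⟩
    onesCount (λ x → f (false VF.∷ x) ∧ proj₁ g₀ x)
      + onesCount (λ x → f (true VF.∷ x) ∧ proj₁ g₁ x)
                                               ≡⟨ cong₂ _+_ (proj₂ g₀) (proj₂ g₁) ⟩
    m ⊓ c₀ + (m ∸ c₀)                          ≡⟨ m⊓n+m∸n≡m m c₀ ⟩
    m                                          ∎)
  where
  open ≡-Reasoning
  m⊓n+m∸n≡m : ∀ m n → m ⊓ n + (m ∸ n) ≡ m
  m⊓n+m∸n≡m m n = trans (cong (_+ (m ∸ n)) (⊓-comm m n)) (m⊓n+n∸m≡n n m)
  c₀ c₁ : ℕ
  c₀ = onesCount (f ∘ (false VF.∷_))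
  c₁ = onesCount (f ∘ (true VF.∷_))
  g₀ : Σ (BoolFun n) λ g → onesCount (λ x → f (false VF.∷ x) ∧ g x) ≡ m ⊓ c₀
  g₀ = trim n (f ∘ (false VF.∷_)) (m ⊓ c₀) (m⊓n≤n m c₀)
  g₁ : Σ (BoolFun n) λ g → onesCount (λ x → f (true VF.∷ x) ∧ g x) ≡ m ∸ c₀
  g₁ = trim n (f ∘ (true VF.∷_)) (m ∸ c₀)
         (m≤n+o⇒m∸n≤o m c₀ (≤-trans m≤ (≤-reflexive (onesCount-suc f))))
  g : BoolFun (suc n)
  g x = if x zero then proj₁ g₁ (VF.tail x) else proj₁ g₀ (VF.tail x)

-- Subcubes

disjoint : Subset n → Subset n → Bool
disjoint []          []      = true
disjoint (true  ∷ A) (s ∷ S) = not s ∧ disjoint A S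
disjoint (false ∷ A) (s ∷ S) = disjoint A S

disjoint-insert : (A S : Subset n) (i : Fin n) →
                  disjoint (A [ i ]≔ true) S ≡ disjoint A S ∧ not (lookup S i)
disjoint-insert (true  ∷ A) (true  ∷ S) zero = refl
disjoint-insert (true  ∷ A) (false ∷ S) zero = sym (∧-identityʳ _)
disjoint-insert (false ∷ A) (s ∷ S) zero = ∧-comm (not s) _
disjoint-insert (true  ∷ A) (s ∷ S) (suc i)
  rewrite disjoint-insert A S i = sym (∧-assoc (not s) _ _)
disjoint-insert (false ∷ A) (s ∷ S) (suc i) = disjoint-insert A S i

∣insert∣ : (A : Subset n) (i : Fin n) → lookup A i ≡ false → ∣ A [ i ]≔ true ∣ ≡ suc ∣ A ∣
∣insert∣ (false ∷ A) zero    eq = refl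
∣insert∣ (true  ∷ A) (suc i) eq = cong suc (∣insert∣ A i eq)
∣insert∣ (false ∷ A) (suc i) eq = ∣insert∣ A i eq

-- `allFin (suc n)` is `zero` followed by a tabulation of `suc`. Moving `suc` into the predicate
-- turns the fold in `vanishesOn` into a recursion along S.
allᵇ-tabulate : (p : B → Bool) (h : A → B) (g : Fin n → A) →
                allᵇ p (tabulate (h ∘ g)) ≡ allᵇ (p ∘ h) (tabulate g)
allᵇ-tabulate {n = zero}  p h g = refl
allᵇ-tabulate {n = suc n} p h g = cong (p (h (g zero)) ∧_) (allᵇ-tabulate p h (g ∘ suc))

vanishesOn-suc : ∀ s (S : Subset n) (x : Point (suc n)) →
                 vanishesOn (s ∷ S) x ≡ not (s ∧ x zero) ∧ vanishesOn S (x ∘ suc)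
vanishesOn-suc {n} false S x = allᵇ-tabulate _ suc (λ (i : Fin n) → i)
vanishesOn-suc {n} true  S x with x zero
... | false = allᵇ-tabulate _ suc (λ (i : Fin n) → i)
... | true  = refl

-- A subcube of codimension |S| has 2^(n-|S|) points; the product form avoids truncated subtraction.
-- Each coordinate doubles the left side, by being free or through the factor `2 ^ ∣ S ∣`.
onesCount-vanishesOn : (S : Subset n) → onesCount (vanishesOn S) * 2 ^ ∣ S ∣ ≡ 2 ^ n
onesCount-vanishesOn []              = refl
onesCount-vanishesOn {suc n} (s ∷ S) = begin
  onesCount (vanishesOn (s ∷ S)) * 2 ^ ∣ s ∷ S ∣
    ≡⟨ cong (_* 2 ^ ∣ s ∷ S ∣) (onesCount-suc (vanishesOn (s ∷ S))) ⟩
  (onesCount (vanishesOn (s ∷ S) ∘ (false VF.∷_)) + onesCount (vanishesOn (s ∷ S) ∘ (true VF.∷_)))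
    * 2 ^ ∣ s ∷ S ∣
    ≡⟨ cong (_* 2 ^ ∣ s ∷ S ∣) (cong₂ _+_
         (countᵇ-cong _ _ (λ x → vanishesOn-suc s S (false VF.∷ x)) (cube n))
         (countᵇ-cong _ _ (λ x → vanishesOn-suc s S (true VF.∷ x)) (cube n))) ⟩
  (onesCount (λ x → not (s ∧ false) ∧ vanishesOn S x) + onesCount (λ x → not (s ∧ true) ∧ vanishesOn S x))
    * 2 ^ ∣ s ∷ S ∣
    ≡⟨ lem s ⟩
  2 * (onesCount (vanishesOn S) * 2 ^ ∣ S ∣)
    ≡⟨ cong (2 *_) (onesCount-vanishesOn S) ⟩
  2 ^ suc n ∎
  where
  open ≡-Reasoning
  free-coordinate : ∀ c p → (c + c) * p ≡ 2 * (c * p)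
  free-coordinate = solve-∀
  fixed-coordinate : ∀ c p → (c + 0) * (2 * p) ≡ 2 * (c * p)
  fixed-coordinate = solve-∀
  lem : ∀ s → (onesCount (λ x → not (s ∧ false) ∧ vanishesOn S x)
                + onesCount (λ x → not (s ∧ true) ∧ vanishesOn S x)) * 2 ^ ∣ s ∷ S ∣
              ≡ 2 * (onesCount (vanishesOn S) * 2 ^ ∣ S ∣)
  lem false = free-coordinate (onesCount (vanishesOn S)) (2 ^ ∣ S ∣)
  lem true rewrite countᵇ-false (cube n) = fixed-coordinate (onesCount (vanishesOn S)) (2 ^ ∣ S ∣)

∣∪∣-disjoint : (A S : Subset n) → disjoint A S ≡ true → ∣ A ∪ S ∣ ≡ ∣ A ∣ + ∣ S ∣
∣∪∣-disjoint []          []          d = refl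
∣∪∣-disjoint (true  ∷ A) (false ∷ S) d = cong suc (∣∪∣-disjoint A S d)
∣∪∣-disjoint (false ∷ A) (true  ∷ S) d =
  trans (cong suc (∣∪∣-disjoint A S d)) (sym (+-suc ∣ A ∣ ∣ S ∣))
∣∪∣-disjoint (false ∷ A) (false ∷ S) d = ∣∪∣-disjoint A S d

∧-true : ∀ {s t} → s ∧ t ≡ true → s ≡ true × t ≡ true
∧-true {true} eq = refl , eq

vanishesOn-∪ʳ : (A S : Subset n) (x : Point n) →
                vanishesOn (A ∪ S) x ≡ true → vanishesOn S x ≡ true
vanishesOn-∪ʳ []      []      x v = refl
vanishesOn-∪ʳ (a ∷ A) (s ∷ S) x v
  with ∧-true {not ((a ∨ s) ∧ x zero)} (trans (sym (vanishesOn-suc (a ∨ s) (A ∪ S) x)) v)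
... | head , tail
  rewrite vanishesOn-suc s S x | vanishesOn-∪ʳ A S (x ∘ suc) tail = lem a s (x zero) head
  where
  lem : ∀ a s b → not ((a ∨ s) ∧ b) ≡ true → not (s ∧ b) ∧ true ≡ true
  lem a     false b     h = refl
  lem a     true  false h = refl
  lem false true  true  h = h
  lem true  true  true  h = h

-- Coordinates in A lie outside S, so there `merge S u v` reads u and the choice of v has no
-- influence.
vanishesOn-merge : (A S : Subset n) (u v : Point n) → disjoint A S ≡ true →
                   vanishesOn (A ∪ S) u ≡ true → vanishesOn A (merge S u v) ≡ true
vanishesOn-merge []      []      u v d h = refl
vanishesOn-merge (a ∷ A) (s ∷ S) u v d h
  with ∧-true {not ((a ∨ s) ∧ u zero)} (trans (sym (vanishesOn-suc (a ∨ s) (A ∪ S) u)) h)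
... | head , tail = trans (vanishesOn-suc a A (merge (s ∷ S) u v)) (lem a s d head)
  where
  lem : ∀ a s → disjoint (a ∷ A) (s ∷ S) ≡ true → not ((a ∨ s) ∧ u zero) ≡ true →
        not (a ∧ merge (s ∷ S) u v zero) ∧ vanishesOn A (merge S (u ∘ suc) (v ∘ suc)) ≡ true
  lem false s     d h = vanishesOn-merge A S (u ∘ suc) (v ∘ suc) d tail
  lem true  false d h rewrite h = vanishesOn-merge A S (u ∘ suc) (v ∘ suc) d tail

-- Greedy covering

-- With `disjoint` for r this selects the sets S that meet every clause. With `vanishesOn` it is the
-- formula f₀, since the clause of A fails at x exactly when x vanishes on A.
none : (A → B → Bool) → List A → B → Bool
none r F b = allᵇ (λ a → not (r a b)) F

-- Each pick hits at least the share 1/(x+1) of what is left, so m picks leave at most the share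
-- (x/(x+1))^m. Writing the reciprocal density as `suc x` avoids subtraction.
greedy-cover : (r : A → B → Bool) (ok : A → Set) (xs : List B) (q : B → Bool) (x : ℕ) →
  (∀ p → (∀ b → p b ≡ true → q b ≡ true) → 0 < countᵇ p xs →
     Σ A λ a → ok a × countᵇ p xs ≤ suc x * countᵇ (λ b → p b ∧ r a b) xs) →
  ∀ m → Σ (List A) λ F → length F ≤ m × All ok F ×
    suc x ^ m * countᵇ (λ b → q b ∧ none r F b) xs ≤ x ^ m * countᵇ q xs
greedy-cover r ok xs q x pick zero =
  [] , z≤n , [] ,
  +-monoˡ-≤ 0 (countᵇ-mono (λ b → q b ∧ true) q (λ b h → proj₁ (∧-true {q b} h)) xs)
greedy-cover {A = A} {B = B} r ok xs q x pick (suc m) with greedy-cover r ok xs q x pick m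
... | F , len , oks , bound with countᵇ (λ b → q b ∧ none r F b) xs in eq
-- Nothing is left, so `pick` does not apply; the family is kept as it is.
...   | zero = F , m≤n⇒m≤1+n len , oks ,
          ≤-trans (≤-reflexive (trans (cong (suc x ^ suc m *_) eq) (*-zeroʳ (suc x ^ suc m)))) z≤n
...   | suc c with pick (λ b → q b ∧ none r F b) (λ b h → proj₁ (∧-true {q b} h))
                        (subst (0 <_) (sym eq) z<s)
...     | a , oka , hit = a ∷ F , s≤s len , oka ∷ oks , (begin
  suc x * suc x ^ m * R                ≡⟨ xy∙z≈y∙xz (suc x) (suc x ^ m) R ⟩
  suc x ^ m * (suc x * R)              ≤⟨ *-monoʳ-≤ (suc x ^ m) shrink ⟩
  suc x ^ m * (x * suc c)              ≡⟨ x∙yz≈y∙xz (suc x ^ m) x (suc c) ⟩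
  x * (suc x ^ m * suc c)              ≤⟨ *-monoʳ-≤ x bound ⟩
  x * (x ^ m * countᵇ q xs)            ≡⟨ *-assoc x (x ^ m) _ ⟨
  x ^ suc m * countᵇ q xs              ∎)
  where
  open ≤-Reasoning
  R H : ℕ
  R = countᵇ (λ b → q b ∧ none r (a ∷ F) b) xs
  H = countᵇ (λ b → (q b ∧ none r F b) ∧ r a b) xs
  split : R + H ≤ suc c
  split = subst (R + H ≤_) eq (countᵇ-disjoint _ _ _ (λ b → lem (q b) (none r F b) (r a b)) xs)
    where
    lem : ∀ s t u → b2n (s ∧ not u ∧ t) + b2n ((s ∧ t) ∧ u) ≤ b2n (s ∧ t)
    lem false t     u     = z≤n
    lem true  false false = z≤n
    lem true  false true  = z≤n
    lem true  true  false = ≤-refl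
    lem true  true  true  = ≤-refl
  -- Of c+1 remaining elements at least (c+1)/(x+1) are hit; adding `suc c` to both sides replaces a
  -- subtraction.
  shrink : suc x * R ≤ x * suc c
  shrink = +-cancelˡ-≤ (suc c) _ _ (begin
    suc c + suc x * R         ≤⟨ +-monoˡ-≤ (suc x * R) (subst (_≤ suc x * H) eq hit) ⟩
    suc x * H + suc x * R     ≡⟨ +-comm (suc x * H) _ ⟩
    suc x * R + suc x * H     ≡⟨ *-distribˡ-+ (suc x) R H ⟨
    suc x * (R + H)           ≤⟨ *-monoʳ-≤ (suc x) split ⟩
    suc x * suc c             ∎)

-- Choosing the k elements of a set one at a time

-- If `b * g i < c` held for every i, summation would give `b * sum g ≤ n * c`. For `n = 0` the
-- strict hypothesis is absurd.
pigeonhole : ∀ n (g : Fin n → ℕ) b c → n * c < b * sum g → ∃ λ i → c ≤ b * g i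
pigeonhole zero    g b c h = contradiction (subst (0 <_) (*-zeroʳ b) h) λ ()
pigeonhole (suc n) g b c h with c ≤? b * g zero
... | yes c≤ = zero , c≤
... | no  c≰ with pigeonhole n (g ∘ suc) b c
                   (+-cancelˡ-< c _ _ (<-≤-trans h (≤-trans
                     (≤-reflexive (*-distribˡ-+ b (g zero) _))
                     (+-monoˡ-≤ _ (<⇒≤ (≰⇒> c≰))))))
...   | i , c≤ = suc i , c≤

-- Sum the hypothesis over the elements of xs satisfying p, then exchange the two summations.
double-count : (xs : List A) (p : A → Bool) (o : Fin n → A → Bool) (w b : ℕ) →
  (∀ a → p a ≡ true → w ≤ b * sum (λ i → b2n (o i a))) →
  w * countᵇ p xs ≤ b * sum (λ i → countᵇ (λ a → p a ∧ o i a) xs)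
double-count []       p o w b h = ≤-trans (≤-reflexive (*-zeroʳ w)) z≤n
double-count (x ∷ xs) p o w b h with p x in eq
... | false = double-count xs p o w b h
... | true  = begin
  w * suc c                                  ≡⟨ *-suc w c ⟩
  w + w * c                                  ≤⟨ +-mono-≤ (h x eq) (double-count xs p o w b h) ⟩
  b * sum (λ i → b2n (o i x)) + b * sum g      ≡⟨ *-distribˡ-+ b _ _ ⟨
  b * (sum (λ i → b2n (o i x)) + sum g)        ≡⟨ cong (b *_) (∑-distrib-+ (λ i → b2n (o i x)) g) ⟨
  b * sum (λ i → b2n (o i x) + g i)           ∎
  where
  open ≤-Reasoning
  c = countᵇ p xs
  g = λ i → countᵇ (λ a → p a ∧ o i a) xs

outsideBoth : Subset n → Fin n → Subset n → Bool
outsideBoth A i S = not (lookup A i) ∧ not (lookup S i)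

Σ-outsideBoth : (A S : Subset n) → n ≤ sum (λ i → b2n (outsideBoth A i S)) + (∣ A ∣ + ∣ S ∣)
Σ-outsideBoth []      []      = z≤n
Σ-outsideBoth (a ∷ A) (s ∷ S) = ≤-trans (s≤s (Σ-outsideBoth A S)) (lem a s)
  where
  σ = sum (λ i → b2n (outsideBoth A i S))
  lem : ∀ a s → suc (σ + (∣ A ∣ + ∣ S ∣))
                ≤ b2n (not a ∧ not s) + σ + (∣ a ∷ A ∣ + ∣ s ∷ S ∣)
  lem false false = ≤-refl
  lem false true  = ≤-reflexive (trans (sym (+-suc σ _)) (cong (σ +_) (sym (+-suc ∣ A ∣ _))))
  lem true  false = ≤-reflexive (sym (+-suc σ _))
  lem true  true  = ≤-trans (≤-reflexive (sym (+-suc σ _)))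
                      (+-monoʳ-≤ σ (s≤s (+-monoʳ-≤ ∣ A ∣ (n≤1+n ∣ S ∣))))

-- For S in the family p and a partial choice A of fewer than k elements, more than the share a/b of
-- all coordinates lies outside both.
module _ {n : ℕ} (p : Subset n → Bool) (a b k : ℕ) .{{_ : NonZero a}}
         (nonempty : 0 < countᵇ p (subsets n))
         (sparse : ∀ S A → p S ≡ true → ∣ A ∣ < k →
                   n * a < b * sum (λ i → b2n (outsideBoth A i S)))
  where

  private
    hits : (Subset n → Bool) → ℕ
    hits q = countᵇ q (subsets n)

  extend : (A : Subset n) (q : Subset n → Bool) → (∀ S → q S ≡ true → p S ≡ true) → ∣ A ∣ < k →
           0 < hits q →
           ∃ λ i → lookup A i ≡ false × a * hits q ≤ b * hits (λ S → q S ∧ not (lookup S i))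
  extend A q q⊆p A<k 0<q = i , avoids (lookup A i) refl , ≤-trans ac≤ (*-monoʳ-≤ b
      (countᵇ-mono (λ S → q S ∧ outsideBoth A i S) (λ S → q S ∧ not (lookup S i))
        (λ S → drop (q S) (lookup A i) (lookup S i)) (subsets n)))
    where
    open ≤-Reasoning
    many : n * (a * hits q) < b * sum (λ i → hits (λ S → q S ∧ outsideBoth A i S))
    many = begin-strict
      n * (a * hits q)    ≡⟨ *-assoc n a _ ⟨
      -- `sparse` is strict, so `double-count` can use the weight n a + 1; as q is nonempty, the
      -- inequality stays strict.
      n * a * hits q      <⟨ *-monoˡ-< (hits q) {{>-nonZero 0<q}} (n<1+n (n * a)) ⟩
      suc (n * a) * hits q
        ≤⟨ double-count (subsets n) q (outsideBoth A) (suc (n * a)) b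
             (λ S qS → sparse S A (q⊆p S qS) A<k) ⟩
      b * sum (λ i → hits (λ S → q S ∧ outsideBoth A i S)) ∎
    found = pigeonhole n (λ i → hits (λ S → q S ∧ outsideBoth A i S)) b (a * hits q) many
    i = proj₁ found
    ac≤ : a * hits q ≤ b * hits (λ S → q S ∧ outsideBoth A i S)
    ac≤ = proj₂ found
    drop : ∀ s t u → s ∧ (not t ∧ not u) ≡ true → s ∧ not u ≡ true
    drop s false u h = h
    drop true true u ()
    -- The index found is automatically new: a member of A is never outside A, so its count would be
    -- 0, while `a * hits q` is positive.
    avoids : ∀ s → lookup A i ≡ s → s ≡ false
    avoids false eq = refl
    avoids true  eq = contradiction 0<0 λ ()
      where
      0<0 : 0 < 0
      0<0 = begin-strict
        0                 <⟨ *-mono-< (>-nonZero⁻¹ a) 0<q ⟩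
        a * hits q        ≤⟨ ac≤ ⟩
        b * hits (λ S → q S ∧ outsideBoth A i S)
          ≡⟨ cong (b *_) (trans (countᵇ-cong _ (λ _ → false)
               (λ S → trans (cong (λ t → q S ∧ (not t ∧ not (lookup S i))) eq) (∧-zeroʳ (q S)))
               (subsets n)) (countᵇ-false (subsets n))) ⟩
        b * 0             ≡⟨ *-zeroʳ b ⟩
        0                 ∎

  -- Each new element keeps at least the share a/b of the sets still disjoint from A, so j elements
  -- keep (a/b)^j.
  popular-set : ∀ j → j ≤ k →
    Σ (Subset n) λ A → ∣ A ∣ ≡ j × a ^ j * hits p ≤ b ^ j * hits (λ S → p S ∧ disjoint A S)
  popular-set zero    j≤k = replicate n false , ∣⊥∣≡0 n ,
    +-monoˡ-≤ 0 (countᵇ-mono p _ (λ S pS → cong₂ _∧_ pS (disjoint-⊥ S)) (subsets n))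
    where
    disjoint-⊥ : ∀ {n} (S : Subset n) → disjoint (replicate n false) S ≡ true
    disjoint-⊥ []      = refl
    disjoint-⊥ (s ∷ S) = disjoint-⊥ S
  popular-set (suc j) j<k with popular-set j (<⇒≤ j<k)
  ... | A , ∣A∣≡j , bound
      with extend A (λ S → p S ∧ disjoint A S) (λ S h → proj₁ (∧-true {p S} h))
             (subst (_< k) (sym ∣A∣≡j) j<k) 0<q
    where
    q : Subset n → Bool
    q S = p S ∧ disjoint A S
    -- The bound for j has a positive left side, so some set has survived.
    0<q : 0 < hits q
    0<q with hits q
    ... | suc _ = z<s
    ... | zero  = contradiction
      (≤-trans (*-mono-< (m^n>0 a j) nonempty) (≤-trans bound (≤-reflexive (*-zeroʳ (b ^ j))))) λ ()
  ...   | i , i∉A , step = A [ i ]≔ true , trans (∣insert∣ A i i∉A) (cong suc ∣A∣≡j) , (begin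
    a * a ^ j * hits p             ≡⟨ *-assoc a (a ^ j) _ ⟩
    a * (a ^ j * hits p)           ≤⟨ *-monoʳ-≤ a bound ⟩
    a * (b ^ j * hits (λ S → p S ∧ disjoint A S))
      ≡⟨ x∙yz≈y∙xz a (b ^ j) _ ⟩
    b ^ j * (a * hits (λ S → p S ∧ disjoint A S))
      ≤⟨ *-monoʳ-≤ (b ^ j) step ⟩
    b ^ j * (b * hits (λ S → (p S ∧ disjoint A S) ∧ not (lookup S i)))
      ≡⟨ cong (λ c → b ^ j * (b * c)) (countᵇ-cong _ _ insert (subsets n)) ⟩
    b ^ j * (b * hits (λ S → p S ∧ disjoint (A [ i ]≔ true) S))
      ≡⟨ x∙yz≈y∙xz (b ^ j) b _ ⟩
    b * (b ^ j * hits (λ S → p S ∧ disjoint (A [ i ]≔ true) S))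
      ≡⟨ *-assoc b (b ^ j) _ ⟨
    b * b ^ j * hits (λ S → p S ∧ disjoint (A [ i ]≔ true) S) ∎)
    where
    open ≤-Reasoning
    insert : ∀ S → (p S ∧ disjoint A S) ∧ not (lookup S i) ≡ p S ∧ disjoint (A [ i ]≔ true) S
    insert S rewrite disjoint-insert A S i = ∧-assoc (p S) _ _

-- Arithmetic

-- For positive x this is (1 + 1/x)^m ≥ 1 + m/x multiplied by x^(m+1).
bernoulli : ∀ x m → x ^ m * (x + m) ≤ suc x ^ m * x
bernoulli x zero    = ≤-reflexive (cong (_+ 0) (+-identityʳ x))
bernoulli x (suc m) = begin
  x * x ^ m * (x + suc m)         ≡⟨ lem₁ x (x ^ m) m ⟩
  x ^ m * (x * x + x * m + x)     ≤⟨ *-monoʳ-≤ (x ^ m) (m≤m+n _ m) ⟩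
  x ^ m * (x * x + x * m + x + m) ≡⟨ lem₂ x (x ^ m) m ⟩
  suc x * (x ^ m * (x + m))       ≤⟨ *-monoʳ-≤ (suc x) (bernoulli x m) ⟩
  suc x * (suc x ^ m * x)         ≡⟨ *-assoc (suc x) (suc x ^ m) x ⟨
  suc x ^ suc m * x               ∎
  where
  open ≤-Reasoning
  lem₁ : ∀ x p m → x * p * (x + suc m) ≡ p * (x * x + x * m + x)
  lem₁ = solve-∀
  lem₂ : ∀ x p m → p * (x * x + x * m + x + m) ≡ suc x * (p * (x + m))
  lem₂ = solve-∀

2*x^m≤[1+x]^m : ∀ x m .{{_ : NonZero x}} → x ≤ m → 2 * x ^ m ≤ suc x ^ m
2*x^m≤[1+x]^m x m x≤m = *-cancelʳ-≤ (2 * x ^ m) (suc x ^ m) x (begin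
  2 * x ^ m * x     ≡⟨ lem x (x ^ m) ⟩
  x ^ m * (x + x)   ≤⟨ *-monoʳ-≤ (x ^ m) (+-monoʳ-≤ x x≤m) ⟩
  x ^ m * (x + m)   ≤⟨ bernoulli x m ⟩
  suc x ^ m * x     ∎)
  where
  open ≤-Reasoning
  lem : ∀ x p → 2 * p * x ≡ p * (x + x)
  lem = solve-∀

-- With L = x + 1 this reads (1 - 1/L)^L ≤ 1/2: every L greedy picks halve the uncovered part.
2*x^[1+x]≤[1+x]^[1+x] : ∀ x → 2 * x ^ suc x ≤ suc x ^ suc x
2*x^[1+x]≤[1+x]^[1+x] zero      = z≤n
2*x^[1+x]≤[1+x]^[1+x] x@(suc _) = 2*x^m≤[1+x]^m x (suc x) (n≤1+n x)

^-distribʳ-* : ∀ m n o → (m * n) ^ o ≡ m ^ o * n ^ o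
^-distribʳ-* m n zero    = refl
^-distribʳ-* m n (suc o) rewrite ^-distribʳ-* m n o = *-interchange m n (m ^ o) (n ^ o)

floor-log₂ : ∀ n → 0 < n → ∃ λ l → 2 ^ l ≤ n × n < 2 ^ suc l
floor-log₂ (suc zero)    _ = 0 , ≤-refl , ≤-refl
floor-log₂ (suc n@(suc _)) _ with floor-log₂ n z<s
... | l , lo , hi with suc n <? 2 ^ suc l
...   | yes n< = l , m≤n⇒m≤1+n lo , n<
...   | no  n≮ = suc l , ≮⇒≥ n≮ ,
  ≤-<-trans hi (^-monoʳ-< 2 ≤-refl (n<1+n (suc l)))

-- The shift by 4 steps over the failure at 3, where 9 > 8.
m²≤2^m : ∀ m → (4 + m) * (4 + m) ≤ 2 ^ (4 + m)
m²≤2^m zero    = ≤-refl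
m²≤2^m (suc m) = begin
  (5 + m) * (5 + m)                       ≤⟨ m≤m+n _ (m * m + 6 * m + 7) ⟩
  (5 + m) * (5 + m) + (m * m + 6 * m + 7) ≡⟨ lem m ⟩
  2 * ((4 + m) * (4 + m))                 ≤⟨ *-monoʳ-≤ 2 (m²≤2^m m) ⟩
  2 ^ (5 + m)                             ∎
  where
  open ≤-Reasoning
  lem : ∀ m → (5 + m) * (5 + m) + (m * m + 6 * m + 7) ≡ 2 * ((4 + m) * (4 + m))
  lem = solve-∀

b2n≤1 : ∀ b → b2n b ≤ 1
b2n≤1 false = z≤n
b2n≤1 true  = ≤-refl

floorPow2<2^ : ∀ α m → suc (floorPow2 α m) ≤ 2 ^ m
floorPow2<2^ α zero    = ≤-refl
floorPow2<2^ α (suc m) = begin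
  suc (2 * F + b2n (bit α m)) ≤⟨ s≤s (+-monoʳ-≤ (2 * F) (b2n≤1 (bit α m))) ⟩
  suc (2 * F + 1)             ≡⟨ lem F ⟩
  2 * suc F                   ≤⟨ *-monoʳ-≤ 2 (floorPow2<2^ α m) ⟩
  2 ^ suc m                   ∎
  where
  open ≤-Reasoning
  F = floorPow2 α m
  lem : ∀ F → suc (2 * F + 1) ≡ 2 * suc F
  lem = solve-∀

-- A zero digit at position m gives α ≤ 1 - 2^{-(m+1)}; here with the denominator 2^{m+1}
-- cleared. The extra summand 2^{m+1} on the left absorbs the later digits.
floorPow2-gap : ∀ α m → bit α m ≡ false → ∀ d →
  floorPow2 α (d + suc m) * 2 ^ suc m + 2 ^ (d + suc m) + 2 ^ suc m ≤ 2 ^ (d + suc m) * 2 ^ suc m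
floorPow2-gap α m eq zero rewrite eq = begin
  (2 * F + 0) * (2 * Y) + 2 * Y + 2 * Y ≡⟨ lem₁ F Y ⟩
  suc F * (4 * Y)                       ≤⟨ *-monoˡ-≤ (4 * Y) (floorPow2<2^ α m) ⟩
  Y * (4 * Y)                           ≡⟨ lem₂ Y ⟩
  2 * Y * (2 * Y)                       ∎
  where
  open ≤-Reasoning
  F = floorPow2 α m
  Y = 2 ^ m
  lem₁ : ∀ F Y → (2 * F + 0) * (2 * Y) + 2 * Y + 2 * Y ≡ suc F * (4 * Y)
  lem₁ = solve-∀
  lem₂ : ∀ Y → Y * (4 * Y) ≡ 2 * Y * (2 * Y)
  lem₂ = solve-∀
floorPow2-gap α m eq (suc d) = begin
  (2 * F + b) * Q + 2 * X + Q ≤⟨ +-monoˡ-≤ Q (+-monoˡ-≤ (2 * X) (*-monoˡ-≤ Q (+-monoʳ-≤ (2 * F) (b2n≤1 (bit α (d + suc m)))))) ⟩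
  (2 * F + 1) * Q + 2 * X + Q ≡⟨ lem₁ F Q X ⟩
  2 * (F * Q + X + Q)         ≤⟨ *-monoʳ-≤ 2 (floorPow2-gap α m eq d) ⟩
  2 * (X * Q)                 ≡⟨ *-assoc 2 X Q ⟨
  2 * X * Q                   ∎
  where
  open ≤-Reasoning
  F = floorPow2 α (d + suc m)
  b = b2n (bit α (d + suc m))
  X = 2 ^ (d + suc m)
  Q = 2 ^ suc m
  lem₁ : ∀ F Q X → (2 * F + 1) * Q + 2 * X + Q ≡ 2 * (F * Q + X + Q)
  lem₁ = solve-∀

-- The clause family

private
  none-false⇒∈ : (r : A → B → Bool) (F : List A) (b : B) →
                 none r F b ≡ false → ∃ λ a → a ∈ F × r a b ≡ true
  none-false⇒∈ r (a ∷ F) b eq with r a b in hit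
  ... | true  = a , here refl , hit
  ... | false with none-false⇒∈ r F b eq
  ...   | a′ , a′∈F , hit′ = a′ , there a′∈F , hit′

  ∈⇒none-false : (r : A → B → Bool) (F : List A) (a : A) (b : B) →
                 a ∈ F → r a b ≡ true → none r F b ≡ false
  ∈⇒none-false r (_ ∷ F) a b (here refl) hit rewrite hit = refl
  ∈⇒none-false r (a′ ∷ F) a b (there a∈F) hit
    rewrite ∈⇒none-false r F a b a∈F hit = ∧-zeroʳ (not (r a′ b))

-- The condition |S| ≤ (1/2 - 1/D) n, multiplied by 2D.
smallᵇ : ℕ → Subset n → Bool
smallᵇ {n} D S = 2 * n + 2 * ∣ S ∣ * D ≤ᵇ n * D

-- Since |A| < k < n/(2D), the number of coordinates outside both sets exceeds n - n/(2D) - (1/2 -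
-- 1/D) n = n (D+1)/(2D).
smallᵇ-sparse : ∀ D k → 2 * D * k < n → (S A : Subset n) → smallᵇ D S ≡ true → ∣ A ∣ < k →
                n * suc D < 2 * D * sum (λ i → b2n (outsideBoth A i S))
smallᵇ-sparse {n} D k 2Dk<n S A small A<k = +-cancelʳ-< (n + n * D) _ _ (begin-strict
  n * suc D + (n + n * D)                      ≡⟨ lem₁ n D ⟩
  2 * D * n + 2 * n                            ≤⟨ +-monoˡ-≤ (2 * n) (*-monoʳ-≤ (2 * D) (Σ-outsideBoth A S)) ⟩
  2 * D * (φ + (∣ A ∣ + ∣ S ∣)) + 2 * n        ≡⟨ lem₂ D φ (∣ A ∣) (∣ S ∣) n ⟩
  2 * D * φ + (2 * D * ∣ A ∣ + (2 * n + 2 * ∣ S ∣ * D))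
    <⟨ +-monoʳ-< (2 * D * φ) (+-mono-<-≤
         (≤-<-trans (*-monoʳ-≤ (2 * D) (<⇒≤ A<k)) 2Dk<n)
         (≤ᵇ⇒≤ _ _ (subst T (sym small) _))) ⟩
  2 * D * φ + (n + n * D)                      ∎)
  where
  open ≤-Reasoning
  φ = sum (λ i → b2n (outsideBoth A i S))
  lem₁ : ∀ n D → n * suc D + (n + n * D) ≡ 2 * D * n + 2 * n
  lem₁ = solve-∀
  lem₂ : ∀ D φ a s n → 2 * D * (φ + (a + s)) + 2 * n ≡ 2 * D * φ + (2 * D * a + (2 * n + 2 * s * D))
  lem₂ = solve-∀

-- With a = D + 1, b = 2 D and k = D j the density (a / b)^k is at least 2^j / 2^k,
-- because (1 + 1/D)^D ≥ 2.
2^j-gain : ∀ D j .{{_ : NonZero D}} → 2 ^ j * D ^ (D * j) ≤ suc D ^ (D * j)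
2^j-gain D j = begin
  2 ^ j * D ^ (D * j)   ≡⟨ cong (2 ^ j *_) (^-*-assoc D D j) ⟨
  2 ^ j * (D ^ D) ^ j   ≡⟨ ^-distribʳ-* 2 (D ^ D) j ⟨
  (2 * D ^ D) ^ j       ≤⟨ ^-monoˡ-≤ j (2*x^m≤[1+x]^m D D ≤-refl) ⟩
  (suc D ^ D) ^ j       ≡⟨ ^-*-assoc (suc D) D j ⟩
  suc D ^ (D * j)       ∎
  where open ≤-Reasoning

-- The share ((D+1)/(2D))^k is at least 2^j/2^k = 1/L by the gain hypothesis.
popular-clause : ∀ D k j L .{{_ : NonZero D}} →
  2 * D * k < n → 2 ^ j * D ^ k ≤ suc D ^ k → 2 ^ k ≡ 2 ^ j * L →
  ∀ p → (∀ (S : Subset n) → p S ≡ true → smallᵇ D S ≡ true) → 0 < countᵇ p (subsets n) →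
  Σ (Subset n) λ A → ∣ A ∣ ≡ k ×
    countᵇ p (subsets n) ≤ L * countᵇ (λ S → p S ∧ disjoint A S) (subsets n)
popular-clause {n} D k j L 2Dk<n gain 2^k≡ p p⊆ nonempty =
  clause , proj₁ (proj₂ popular) ,
  *-cancelˡ-≤ (2 ^ j * D ^ k) {{m*n≢0 _ _ {{m^n≢0 2 j}} {{m^n≢0 D k}}}} (begin
    2 ^ j * D ^ k * c        ≤⟨ *-monoˡ-≤ c gain ⟩
    suc D ^ k * c            ≤⟨ proj₂ (proj₂ popular) ⟩
    (2 * D) ^ k * d          ≡⟨ cong (_* d) (^-distribʳ-* 2 D k) ⟩
    2 ^ k * D ^ k * d        ≡⟨ cong (λ t → t * D ^ k * d) 2^k≡ ⟩
    2 ^ j * L * D ^ k * d    ≡⟨ lem (2 ^ j) L (D ^ k) d ⟩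
    2 ^ j * D ^ k * (L * d)  ∎)
  where
  open ≤-Reasoning
  popular = popular-set p (suc D) (2 * D) k nonempty
    (λ S A pS A<k → smallᵇ-sparse D k 2Dk<n S A (p⊆ S pS) A<k) k ≤-refl
  clause : Subset n
  clause = proj₁ popular
  c d : ℕ
  c = countᵇ p (subsets n)
  d = countᵇ (λ S → p S ∧ disjoint clause S) (subsets n)
  lem : ∀ a b c d → a * b * c * d ≡ a * c * (b * d)
  lem = solve-∀

clauses : ∀ n D k j L .{{_ : NonZero D}} →
  2 * D * k < n → 2 ^ j * D ^ k ≤ suc D ^ k → 2 ^ k ≡ 2 ^ j * L →
  Σ (List (Subset n)) λ F → length F ≤ L * suc n × All (λ A → ∣ A ∣ ≡ k) F ×
    (∀ S → smallᵇ D S ≡ true → ∃ λ A → A ∈ F × disjoint A S ≡ true)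
-- L = 0 would make a power of two vanish.
clauses n D k j zero 2Dk<n gain 2^k≡ =
  contradiction (trans 2^k≡ (*-zeroʳ (2 ^ j))) (≢-nonZero⁻¹ _ {{m^n≢0 2 k}})
clauses n D k j (suc x) 2Dk<n gain 2^k≡ = F , proj₁ (proj₂ cover) , proj₁ (proj₂ (proj₂ cover)) , covered
  where
  open ≤-Reasoning
  L m : ℕ
  L = suc x
  -- This allows n + 1 halvings, which bring at most 2^n sets below one.
  m = L * suc n
  cover = greedy-cover disjoint (λ A → ∣ A ∣ ≡ k) (subsets n) (smallᵇ D) x
            (popular-clause D k j L 2Dk<n gain 2^k≡) m
  F : List (Subset n)
  F = proj₁ cover
  uncovered total : ℕ
  uncovered = countᵇ (λ S → smallᵇ D S ∧ none disjoint F S) (subsets n)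
  total = countᵇ (smallᵇ D) (subsets n)
  halved : 2 ^ suc n * x ^ m ≤ L ^ m
  halved = begin
    2 ^ suc n * x ^ m          ≡⟨ cong (2 ^ suc n *_) (^-*-assoc x L (suc n)) ⟨
    2 ^ suc n * (x ^ L) ^ suc n ≡⟨ ^-distribʳ-* 2 (x ^ L) (suc n) ⟨
    (2 * x ^ L) ^ suc n        ≤⟨ ^-monoˡ-≤ (suc n) (2*x^[1+x]≤[1+x]^[1+x] x) ⟩
    (L ^ L) ^ suc n            ≡⟨ ^-*-assoc L L (suc n) ⟩
    L ^ m                      ∎
  uncovered-bound : 2 ^ suc n * uncovered ≤ 2 ^ n
  uncovered-bound = *-cancelˡ-≤ (L ^ m) {{m^n≢0 L m}} (begin
    L ^ m * (2 ^ suc n * uncovered)  ≡⟨ x∙yz≈y∙xz (L ^ m) (2 ^ suc n) uncovered ⟩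
    2 ^ suc n * (L ^ m * uncovered)  ≤⟨ *-monoʳ-≤ (2 ^ suc n) (proj₂ (proj₂ (proj₂ cover))) ⟩
    2 ^ suc n * (x ^ m * total)      ≡⟨ *-assoc (2 ^ suc n) (x ^ m) total ⟨
    2 ^ suc n * x ^ m * total        ≤⟨ *-mono-≤ halved (countᵇ-subsets-≤ n (smallᵇ D)) ⟩
    L ^ m * 2 ^ n                    ∎)
  none-uncovered : uncovered ≡ 0
  none-uncovered = n<1⇒n≡0 (*-cancelˡ-< (2 ^ suc n) uncovered 1 (begin-strict
    2 ^ suc n * uncovered  ≤⟨ uncovered-bound ⟩
    2 ^ n                  <⟨ ^-monoʳ-< 2 ≤-refl (n<1+n n) ⟩
    2 ^ suc n              ≡⟨ *-identityʳ _ ⟨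
    2 ^ suc n * 1          ∎))
  covered : ∀ S → smallᵇ D S ≡ true → ∃ λ A → A ∈ F × disjoint A S ≡ true
  covered S small = none-false⇒∈ disjoint F S
    (trans (cong (_∧ none disjoint F S) (sym small))
           (countᵇ-subsets-≡0 n (λ S → smallᵇ D S ∧ none disjoint F S) none-uncovered S))

-- The function

-- The union bound μ(f₀) ≥ 1 - |F| 2^(-k), multiplied by 2^n 2^k: each clause removes one subcube of
-- codimension k.
none-vanishesOn-volume : ∀ k (F : List (Subset n)) → All (λ A → ∣ A ∣ ≡ k) F →
  2 ^ n * 2 ^ k ≤ onesCount (none vanishesOn F) * 2 ^ k + length F * 2 ^ n
none-vanishesOn-volume {n} k [] [] =
  ≤-reflexive (trans (cong (_* 2 ^ k) (sym (onesCount-true n))) (sym (+-identityʳ _)))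
none-vanishesOn-volume {n} k (A ∷ F) (∣A∣≡k ∷ oks) = begin
  2 ^ n * 2 ^ k                        ≤⟨ none-vanishesOn-volume k F oks ⟩
  c * 2 ^ k + length F * 2 ^ n         ≤⟨ +-monoˡ-≤ _ (*-monoˡ-≤ (2 ^ k) split) ⟩
  (c′ + v) * 2 ^ k + length F * 2 ^ n  ≡⟨ lem c′ v (2 ^ k) (length F * 2 ^ n) ⟩
  c′ * 2 ^ k + (v * 2 ^ k + length F * 2 ^ n)
    ≡⟨ cong (λ t → c′ * 2 ^ k + (t + length F * 2 ^ n))
         (trans (cong (λ i → v * 2 ^ i) (sym ∣A∣≡k)) (onesCount-vanishesOn A)) ⟩
  c′ * 2 ^ k + suc (length F) * 2 ^ n  ∎
  where
  open ≤-Reasoning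
  c c′ v : ℕ
  c  = onesCount (none vanishesOn F)
  c′ = onesCount (none vanishesOn (A ∷ F))
  v  = onesCount (vanishesOn A)
  lem : ∀ a b p z → (a + b) * p + z ≡ a * p + (b * p + z)
  lem = solve-∀
  split : c ≤ c′ + v
  split = countᵇ-cover _ _ _ (λ x → lem₂ (vanishesOn A x) (none vanishesOn F x)) (cube n)
    where
    lem₂ : ∀ s t → b2n t ≤ b2n (not s ∧ t) + b2n s
    lem₂ s     false = z≤n
    lem₂ false true  = ≤-refl
    lem₂ true  true  = ≤-refl

anyᵇ-false : (p : A → Bool) → (∀ a → p a ≡ false) → ∀ xs → anyᵇ p xs ≡ false
anyᵇ-false p h []       = refl
anyᵇ-false p h (x ∷ xs) rewrite h x = anyᵇ-false p h xs

-- Setting the variables outside S to 0 on A already forces f to vanish.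
clause⇒JplusBelow : ∀ k C (f : BoolFun n) (A S : Subset n) →
  (∀ x → vanishesOn A x ≡ true → f x ≡ false) → disjoint A S ≡ true → ∣ A ∣ ≡ k →
  2 ^ k < n ^ C → JplusBelow f S C
clause⇒JplusBelow {n} k C f A S kills d ∣A∣≡k 2^k<n^C =
  -- V counts all settings outside S, and the W = V/2^k of them vanishing on A are forced. So N ≤ V
  -- - W, and W > V/n^C.
  subst (λ V → N * n ^ C + V < n ^ C * V) V≡ (begin-strict
    N * n ^ C + V          ≡⟨ cong (N * n ^ C +_) W2^k≡V ⟨
    N * n ^ C + W * 2 ^ k  <⟨ +-monoʳ-< (N * n ^ C) (*-monoʳ-< W {{W≢0}} 2^k<n^C) ⟩
    N * n ^ C + W * n ^ C  ≡⟨ *-distribʳ-+ (n ^ C) N W ⟨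
    (N + W) * n ^ C        ≤⟨ *-monoˡ-≤ (n ^ C) N+W≤V ⟩
    V * n ^ C              ≡⟨ *-comm V (n ^ C) ⟩
    n ^ C * V              ∎)
  where
  open ≤-Reasoning
  s N V W : ℕ
  s = ∣ S ∣
  N = notForcedCount f S
  V = onesCount (vanishesOn S)
  W = onesCount (vanishesOn (A ∪ S))
  W2^k≡V : W * 2 ^ k ≡ V
  W2^k≡V = *-cancelʳ-≡ (W * 2 ^ k) V (2 ^ s) {{m^n≢0 2 s}} (begin-equality
    W * 2 ^ k * 2 ^ s      ≡⟨ *-assoc W (2 ^ k) (2 ^ s) ⟩
    W * (2 ^ k * 2 ^ s)    ≡⟨ cong (W *_) (^-distribˡ-+-* 2 k s) ⟨
    W * 2 ^ (k + s)        ≡⟨ cong (λ i → W * 2 ^ i) (trans (∣∪∣-disjoint A S d) (cong (_+ s) ∣A∣≡k)) ⟨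
    W * 2 ^ ∣ A ∪ S ∣      ≡⟨ onesCount-vanishesOn (A ∪ S) ⟩
    2 ^ n                  ≡⟨ onesCount-vanishesOn S ⟨
    V * 2 ^ s              ∎)
  V≡ : V ≡ 2 ^ (n ∸ s)
  V≡ = *-cancelʳ-≡ V (2 ^ (n ∸ s)) (2 ^ s) {{m^n≢0 2 s}} (begin-equality
    V * 2 ^ s              ≡⟨ onesCount-vanishesOn S ⟩
    2 ^ n                  ≡⟨ cong (2 ^_) (m∸n+n≡m (∣p∣≤n S)) ⟨
    2 ^ (n ∸ s + s)        ≡⟨ ^-distribˡ-+-* 2 (n ∸ s) s ⟩
    2 ^ (n ∸ s) * 2 ^ s    ∎)
  W≢0 : NonZero W
  W≢0 = ≢-nonZero λ W≡0 → ≢-nonZero⁻¹ (2 ^ (n ∸ s)) {{m^n≢0 2 (n ∸ s)}}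
    (trans (sym V≡) (trans (sym W2^k≡V) (cong (_* 2 ^ k) W≡0)))
  N+W≤V : N + W ≤ V
  N+W≤V = countᵇ-disjoint (λ u → vanishesOn S u ∧ possible u) (vanishesOn (A ∪ S)) (vanishesOn S) pointwise (cube n)
    where
    possible : Point n → Bool
    possible u = anyᵇ (λ v → f (merge S u v)) (cube n)
    drop : ∀ s t → b2n (s ∧ t) + 0 ≤ b2n s
    drop false t     = z≤n
    drop true  false = z≤n
    drop true  true  = ≤-refl
    pointwise : ∀ u → b2n (vanishesOn S u ∧ possible u) + b2n (vanishesOn (A ∪ S) u) ≤ b2n (vanishesOn S u)
    pointwise u with vanishesOn (A ∪ S) u in eq
    ... | false = drop (vanishesOn S u) (possible u)
    ... | true
      rewrite vanishesOn-∪ʳ A S u eq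
            | anyᵇ-false (λ v → f (merge S u v)) (λ v → kills _ (vanishesOn-merge A S u v d eq)) (cube n)
      = ≤-refl

-- With X the size of the cube: the target satisfies F ≤ (1 - 2^(-q)) X, the formula has c ≥ (1 -
-- len 2^(-k)) X ones, and len 2^(-k) ≤ 2^(-q).
room : ∀ (F k q c len X : ℕ) → F * 2 ^ q + X ≤ X * 2 ^ q → len * 2 ^ q ≤ 2 ^ k →
       X * 2 ^ k ≤ c * 2 ^ k + len * X → F ≤ c
room F k q c len X gap few vol = *-cancelʳ-≤ F c (K * Q) {{m*n≢0 K Q {{m^n≢0 2 k}} {{m^n≢0 2 q}}}}
  (+-cancelʳ-≤ (K * X) _ _ (begin
    F * (K * Q) + K * X          ≡⟨ lem₁ F K Q X ⟩
    K * (F * Q + X)              ≤⟨ *-monoʳ-≤ K gap ⟩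
    K * (X * Q)                  ≡⟨ lem₂ K X Q ⟩
    X * K * Q                    ≤⟨ *-monoˡ-≤ Q vol ⟩
    (c * K + len * X) * Q        ≡⟨ lem₃ c K len X Q ⟩
    c * (K * Q) + len * Q * X    ≤⟨ +-monoʳ-≤ (c * (K * Q)) (*-monoˡ-≤ X few) ⟩
    c * (K * Q) + K * X          ∎))
  where
  open ≤-Reasoning
  K = 2 ^ k
  Q = 2 ^ q
  lem₁ : ∀ F K Q X → F * (K * Q) + K * X ≡ K * (F * Q + X)
  lem₁ = solve-∀
  lem₂ : ∀ K X Q → K * (X * Q) ≡ X * K * Q
  lem₂ = solve-∀
  lem₃ : ∀ c K l X Q → (c * K + l * X) * Q ≡ c * (K * Q) + l * Q * X
  lem₃ = solve-∀

-- A digit 1 at position m gives δ ≥ 2^(-(m+1)) = 1/D, visible already in the truncation to m + 1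
-- digits.
half-minus⇒small : ∀ δ m → bit δ m ≡ true → (S : Subset n) → IsFloorHalfMinus δ n ∣ S ∣ →
                   smallᵇ (2 ^ suc m) S ≡ true
half-minus⇒small {n} δ m one S (lower , _) = T⇒≡true (≤⇒≤ᵇ (begin
  2 * n + 2 * ∣ S ∣ * D        ≤⟨ +-monoˡ-≤ _ (≤-trans (≤-reflexive (sym (*-identityˡ (2 * n)))) (*-monoˡ-≤ (2 * n) 1≤F)) ⟩
  F * (2 * n) + 2 * ∣ S ∣ * D  ≤⟨ lower (suc m) ⟩
  n * D                        ∎))
  where
  open ≤-Reasoning
  D F : ℕ
  D = 2 ^ suc m
  F = floorPow2 δ (suc m)
  1≤F : 1 ≤ F
  1≤F rewrite one = m≤n+m 1 (2 * floorPow2 δ m)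
  T⇒≡true : ∀ {b} → T b → b ≡ true
  T⇒≡true {true} _ = refl

-- Choice of the parameters

record Parameters (D q n : ℕ) : Set where
  field
    k j L        : ℕ
    2Dk<n        : 2 * D * k < n
    gain         : 2 ^ j * D ^ k ≤ suc D ^ k
    2^k≡2^j*L    : 2 ^ k ≡ 2 ^ j * L
    family-small : L * suc n * 2 ^ q ≤ 2 ^ k
    2^k<n^C      : 2 ^ k < n ^ suc (D + D)
    q≤n          : q ≤ n

-- k = D j with 2^j ≈ 2^q n, so that the clauses have total measure at most 2^{-q},
-- while 2^k is polynomial in n.
module _ (D q n : ℕ) .{{_ : NonZero D}} (large : 2 ^ (4 * (D * D) + q + 4) ≤ n) where

  private
    open ≤-Reasoning

    0<n : 0 < n
    0<n = ≤-trans (m^n>0 2 (4 * (D * D) + q + 4)) large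
    log : ∃ λ l → 2 ^ l ≤ n × n < 2 ^ suc l
    log = floor-log₂ n 0<n
    l : ℕ
    l = proj₁ log
    2^l≤n : 2 ^ l ≤ n
    2^l≤n = proj₁ (proj₂ log)
    -- Of the threshold, 4D² serves `2Dk<n`, q serves `j≤2l`, and 4 serves `l²≤n`.
    l-large : 4 * (D * D) + q + 4 ≤ l
    l-large = ≮⇒≥ λ l< → <⇒≱ (proj₂ (proj₂ log)) (≤-trans (^-monoʳ-≤ 2 l<) large)
    4≤l : 4 ≤ l
    4≤l = ≤-trans (m≤n+m 4 (4 * (D * D) + q)) l-large
    l≢0 : NonZero l
    l≢0 = >-nonZero (≤-trans (s≤s z≤n) 4≤l)

    j k L : ℕ
    -- The additional 1 gives 2^j ≥ (n + 1) 2^q, matching the n + 1 halvings.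
    j = suc l + q
    k = D * j
    L = 2 ^ (pred D * j)

    j≤2l : j ≤ l + l
    j≤2l = begin
      suc l + q      ≡⟨ +-suc l q ⟨
      l + suc q      ≤⟨ +-monoʳ-≤ l (≤-trans (lem (4 * (D * D)) q) l-large) ⟩
      l + l          ∎
      where
      lem : ∀ x q → suc q ≤ x + q + 4
      lem x q = ≤-trans (≤-reflexive (+-comm 1 q)) (+-mono-≤ (m≤n+m q x) (s≤s z≤n))
    l²≤n : l * l ≤ n
    l²≤n = begin
      l * l                          ≡⟨ cong (λ t → t * t) (m+[n∸m]≡n 4≤l) ⟨
      (4 + (l ∸ 4)) * (4 + (l ∸ 4))  ≤⟨ m²≤2^m (l ∸ 4) ⟩
      2 ^ (4 + (l ∸ 4))              ≡⟨ cong (2 ^_) (m+[n∸m]≡n 4≤l) ⟩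
      2 ^ l                          ≤⟨ 2^l≤n ⟩
      n                              ∎

    2Dk<n : 2 * D * k < n
    2Dk<n = begin-strict
      2 * D * (D * j)        ≤⟨ *-monoʳ-≤ (2 * D) (*-monoʳ-≤ D j≤2l) ⟩
      2 * D * (D * (l + l))  ≡⟨ lem D l ⟩
      4 * (D * D) * l        <⟨ *-monoˡ-< l {{l≢0}} 4D²<l ⟩
      l * l                  ≤⟨ l²≤n ⟩
      n                      ∎
      where
      lem : ∀ D l → 2 * D * (D * (l + l)) ≡ 4 * (D * D) * l
      lem = solve-∀
      4D²<l : 4 * (D * D) < l
      4D²<l = ≤-trans (≤-trans (≤-reflexive (+-comm 1 (4 * (D * D))))
        (+-mono-≤ (m≤m+n (4 * (D * D)) q) (s≤s z≤n))) l-large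

    2^k≡2^j*L : 2 ^ k ≡ 2 ^ j * L
    2^k≡2^j*L = trans (cong (λ t → 2 ^ (t * j)) (sym (suc-pred D))) (^-distribˡ-+-* 2 j (pred D * j))

    family-small : L * suc n * 2 ^ q ≤ 2 ^ k
    family-small = begin
      L * suc n * 2 ^ q        ≤⟨ *-monoˡ-≤ (2 ^ q) (*-monoʳ-≤ L (proj₂ (proj₂ log))) ⟩
      L * 2 ^ suc l * 2 ^ q    ≡⟨ lem L (2 ^ suc l) (2 ^ q) ⟩
      2 ^ suc l * 2 ^ q * L    ≡⟨ cong (_* L) (^-distribˡ-+-* 2 (suc l) q) ⟨
      2 ^ j * L                ≡⟨ 2^k≡2^j*L ⟨
      2 ^ k                    ∎
      where
      lem : ∀ a b c → a * b * c ≡ b * c * a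
      lem = solve-∀

    2^k<n^C : 2 ^ k < n ^ suc (D + D)
    2^k<n^C = begin-strict
      2 ^ (D * j)          ≤⟨ ^-monoʳ-≤ 2 (*-monoʳ-≤ D j≤2l) ⟩
      2 ^ (D * (l + l))    ≡⟨ cong (2 ^_) (lem D l) ⟩
      2 ^ (l * (D + D))    ≡⟨ ^-*-assoc 2 l (D + D) ⟨
      (2 ^ l) ^ (D + D)    ≤⟨ ^-monoˡ-≤ (D + D) 2^l≤n ⟩
      -- One spare factor n makes the bound strict, hence the exponent 2D + 1.
      n ^ (D + D)          <⟨ ^-monoʳ-< n (≤-trans (s≤s (s≤s z≤n)) 4≤n) (n<1+n (D + D)) ⟩
      n ^ suc (D + D)      ∎
      where
      lem : ∀ D l → D * (l + l) ≡ l * (D + D)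
      lem = solve-∀
      4≤n : 4 ≤ n
      4≤n = ≤-trans 4≤l (≤-trans (m≤m*n l l {{l≢0}}) l²≤n)

    q≤n : q ≤ n
    q≤n = begin
      q                    ≤⟨ m≤n+m q (4 * (D * D)) ⟩
      4 * (D * D) + q      ≤⟨ m≤m+n _ 4 ⟩
      4 * (D * D) + q + 4  ≤⟨ l-large ⟩
      l                    ≤⟨ m≤m*n l l {{l≢0}} ⟩
      l * l                ≤⟨ l²≤n ⟩
      n                    ∎

  parameters : Parameters D q n
  parameters = record
    { k = k ; j = j ; L = L
    ; 2Dk<n = 2Dk<n ; gain = 2^j-gain D j ; 2^k≡2^j*L = 2^k≡2^j*L
    ; family-small = family-small ; 2^k<n^C = 2^k<n^C ; q≤n = q≤n }

-- Assembly

construction : ∀ D q {n} .{{_ : NonZero D}} → Parameters D q n → ∀ F →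
  (q ≤ n → F * 2 ^ q + 2 ^ n ≤ 2 ^ n * 2 ^ q) →
  Σ (BoolFun n) λ f → onesCount f ≡ F × (∀ S → smallᵇ D S ≡ true → JplusBelow f S (suc (D + D)))
construction D q {n} params F gap = f , proj₂ trimmed , below
  where
  open Parameters params
  family = clauses n D k j L 2Dk<n gain 2^k≡2^j*L
  𝓕 : List (Subset n)
  𝓕 = proj₁ family
  sizes : All (λ A → ∣ A ∣ ≡ k) 𝓕
  sizes = proj₁ (proj₂ (proj₂ family))
  trimmed : Σ (BoolFun n) λ g → onesCount (λ x → none vanishesOn 𝓕 x ∧ g x) ≡ F
  trimmed = trim n (none vanishesOn 𝓕) F
    (room F k q _ (length 𝓕) (2 ^ n) (gap q≤n)
      (≤-trans (*-monoˡ-≤ (2 ^ q) (proj₁ (proj₂ family))) family-small)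
      (none-vanishesOn-volume k 𝓕 sizes))
  f : BoolFun n
  -- Trimming only removes ones, so a failing clause still forces the value `false`.
  f x = none vanishesOn 𝓕 x ∧ proj₁ trimmed x
  below : ∀ S → smallᵇ D S ≡ true → JplusBelow f S (suc (D + D))
  below S small with proj₂ (proj₂ (proj₂ family)) S small
  ... | A , A∈𝓕 , disj = clause⇒JplusBelow k (suc (D + D)) f A S
    (λ x hit → cong (_∧ proj₁ trimmed x) (∈⇒none-false vanishesOn 𝓕 A x A∈𝓕 hit))
    disj (All.lookup sizes A∈𝓕) 2^k<n^C

theorem1p1 : (α δ : UnitReal) →
    Σ ℕ λ C → 1 ≤ C × Σ ℕ λ N → (n : ℕ) → N ≤ n →
    Σ (BoolFun n) λ f →
    onesCount f ≡ floorPow2 α n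
    × ((S : Subset n) → IsFloorHalfMinus δ n ∣ S ∣ → JplusBelow f S C)
theorem1p1 α δ with notAllOnes α 0 | nonzero δ
... | m₀ , _ , α-zero | m₁ , δ-one = suc (D + D) , s≤s z≤n , 2 ^ (4 * (D * D) + q + 4) , λ n large →
  let f , size , below = construction D q {{D≢0}} (parameters D q n {{D≢0}} large) (floorPow2 α n) gap
  in f , size , λ S isFloor → below S (half-minus⇒small δ m₁ δ-one S isFloor)
  where
  q D : ℕ
  -- A zero digit of α gives α ≤ 1 - 2^(-q); a digit 1 of δ gives 1/D ≤ δ.
  q = suc m₀
  D = 2 ^ suc m₁
  D≢0 : NonZero D
  D≢0 = m^n≢0 2 (suc m₁)
  gap : ∀ {n} → q ≤ n → floorPow2 α n * 2 ^ q + 2 ^ n ≤ 2 ^ n * 2 ^ q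
  gap {n} q≤n = subst (λ i → floorPow2 α i * 2 ^ q + 2 ^ i ≤ 2 ^ i * 2 ^ q) (m∸n+n≡m q≤n)
    (m+n≤o⇒m≤o _ (floorPow2-gap α m₀ α-zero (n ∸ q)))
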